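{- Let $k \ge 0$ be an integer and let $G$ be a graph on $n$ vertices with average degree $d$ and minimum degree $\delta$. Then $$\alpha_{k-\mathrm{reg}}(G) \ge \frac{n}{(2d-2\delta+1)\,\chi_k(G)}.$$
   Context: Graphs are finite and simple. A $k$-independent set is a set of vertices whose induced subgraph has maximum degree at most $k$. The regular $k$-independence number $\alpha_{k-\mathrm{reg}}(G)$ is the maximum cardinality of a $k$-independent set of $G$ all of whose vertices have the same degree in $G$. The $k$-chromatic number $\chi_k(G)$ is the minimum number of colors needed to color the vertices of $G$ so that the subgraph induced by each color class has maximum degree at most $k$. -}

module Defs where

open import Data.Fin.Base using (Fin; zero; suc; finToFun; funToFin)
import Data.Fin.Properties as Fin
open import Data.Fin.Subset using (Subset; _∈_; _∩_; ∣_∣; ⊥)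
open import Data.Fin.Subset.Properties
  using (_∈?_; anySubset?; ∉⊥; ∣⊥∣≡0; ∣p∣≤n; x∈p∩q⁻; Empty-unique)
import Data.Integer.Base as ℤ
import Data.Integer.Properties as ℤ
open import Data.List.Base as List using (List; filter; upTo; sum)
open import Data.List.Extrema.Nat
  using (min; max; argmin-sel; argmin-all; argmax-all; min≤xs; min≤⊤; xs≤max)
open import Data.List.Membership.Propositional.Properties
  using (∈-filter⁺; ∈-upTo⁺; ∈-tabulate⁺; ∈-tabulate⁻)
open import Data.List.Relation.Unary.All as All using ()
open import Data.List.Relation.Unary.All.Properties using (all-filter)
open import Data.Nat.Base as ℕ using (ℕ; zero; suc; s≤s; z≤n)
import Data.Nat.Properties as ℕ
open import Data.Product.Base using (∃-syntax; _×_; _,_)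
open import Data.Rational.Base as ℚ using (ℚ; 1ℚ)
import Data.Rational.Properties as ℚ
import Data.Rational.Unnormalised.Base as ℚᵘ
import Data.Rational.Unnormalised.Properties as ℚᵘ
open import Data.Sum.Base using (inj₁; inj₂)
open import Data.Vec.Base as Vec using ()
import Data.Vec.Properties as Vec
open import Function.Base using (_∘_; id)
open import Level using (0ℓ)
open import Relation.Binary.Core using (Rel)
open import Relation.Binary.Definitions using (Decidable; Symmetric; Irreflexive)
open import Relation.Binary.PropositionalEquality
  using (_≡_; _≗_; refl; sym; trans; cong; subst)
open import Relation.Nullary.Decidable
  using (Dec; yes; no; does; map′; _×-dec_; _→-dec_)
open import Relation.Nullary.Negation using (contradiction)

-- Finite simple graphs, with vertex set Fin n.

record Graph (n : ℕ) : Set₁ where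
  infix 4 _~_ _~?_
  field
    _~_      : Rel (Fin n) 0ℓ
    _~?_     : Decidable _~_
    ~-sym    : Symmetric _~_
    ~-irrefl : Irreflexive _≡_ _~_

open Graph public using (_~_; _~?_; ~-sym; ~-irrefl)

module _ {n : ℕ} (G : Graph n) where

  neighbours : Fin n → Subset n
  neighbours v = Vec.tabulate (λ u → does (_~?_ G v u))

  degree : Fin n → ℕ
  degree v = ∣ neighbours v ∣

  degrees : List ℕ
  degrees = List.tabulate degree

  -- Degrees are less than n, so the default value n only matters for n ≡ 0.
  minDegree : ℕ
  minDegree = min n degrees

  averageDegree : .{{_ : ℕ.NonZero n}} → ℚ
  averageDegree = ℤ.+ sum degrees ℚ./ n

  -- For v ∈ S, this is the degree of v in the subgraph induced by S.
  degreeIn : Subset n → Fin n → ℕ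
  degreeIn S v = ∣ neighbours v ∩ S ∣

  IsIndependent : ℕ → Subset n → Set
  IsIndependent k S = ∀ v → v ∈ S → degreeIn S v ℕ.≤ k

  IsDegreeRegular : Subset n → Set
  IsDegreeRegular S = ∀ u → u ∈ S → ∀ v → v ∈ S → degree u ≡ degree v

  HasRegularIndependentSet : ℕ → ℕ → Set
  HasRegularIndependentSet k m =
    ∃[ S ] (IsIndependent k S × IsDegreeRegular S × ∣ S ∣ ≡ m)

  colourClass : ∀ {c} → (Fin n → Fin c) → Fin c → Subset n
  colourClass f i = Vec.tabulate (λ v → does (f v Fin.≟ i))

  IsColouring : ℕ → ∀ {c} → (Fin n → Fin c) → Set
  IsColouring k f = ∀ i → IsIndependent k (colourClass f i)

  Colourable : ℕ → ℕ → Set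
  Colourable k c = ∃[ f ] IsColouring k {c} f

  isIndependent? : ∀ k S → Dec (IsIndependent k S)
  isIndependent? k S = Fin.all? λ v → (v ∈? S) →-dec (degreeIn S v ℕ.≤? k)

  isDegreeRegular? : ∀ S → Dec (IsDegreeRegular S)
  isDegreeRegular? S = Fin.all? λ u → (u ∈? S) →-dec
    Fin.all? λ v → (v ∈? S) →-dec (degree u ℕ.≟ degree v)

  hasRegularIndependentSet? : ∀ k m → Dec (HasRegularIndependentSet k m)
  hasRegularIndependentSet? k m = anySubset? λ S →
    isIndependent? k S ×-dec isDegreeRegular? S ×-dec (∣ S ∣ ℕ.≟ m)

  isColouring-resp-≗ : ∀ k {c} {f g : Fin n → Fin c} → f ≗ g →
                       IsColouring k f → IsColouring k g
  isColouring-resp-≗ k f≗g col i = subst (IsIndependent k)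
    (Vec.tabulate-cong (λ v → cong (λ j → does (j Fin.≟ i)) (f≗g v))) (col i)

  colourable? : ∀ k c → Dec (Colourable k c)
  colourable? k c = map′
    (λ (x , col) → finToFun x , col)
    (λ (f , col) → funToFin f ,
      isColouring-resp-≗ k (λ v → sym (Fin.finToFun-funToFin f v)) col)
    (Fin.any? λ x → Fin.all? λ i → isIndependent? k (colourClass (finToFun {c} {n} x) i))

  -- The default value 0 is attained by the empty set.
  α-reg : ℕ → ℕ
  α-reg k = max 0 (filter (hasRegularIndependentSet? k) (upTo (suc n)))

  -- The default value n is attained by giving each vertex its own colour.
  χ : ℕ → ℕ
  χ k = min n (filter (colourable? k) (upTo n))

-- α-reg is the maximum, and χ and minDegree are the minima, they should be.

module _ {n : ℕ} (G : Graph n) where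

  α-reg-attained : ∀ k → HasRegularIndependentSet G k (α-reg G k)
  α-reg-attained k = argmax-all id {P = HasRegularIndependentSet G k}
    (⊥ , (λ v v∈⊥ → contradiction v∈⊥ ∉⊥)
       , (λ u u∈⊥ → contradiction u∈⊥ ∉⊥) , ∣⊥∣≡0 n)
    (all-filter (hasRegularIndependentSet? G k) (upTo (suc n)))

  α-reg-greatest : ∀ k S → IsIndependent G k S → IsDegreeRegular G S →
                   ∣ S ∣ ℕ.≤ α-reg G k
  α-reg-greatest k S ind reg = All.lookup (xs≤max 0 _)
    (∈-filter⁺ (hasRegularIndependentSet? G k) (∈-upTo⁺ (s≤s (∣p∣≤n S)))
      (S , ind , reg , refl))

  -- In the colouring by id every colour class is a singleton.
  n-colourable : ∀ k → Colourable G k n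
  n-colourable k = id , λ i v v∈i →
    ℕ.≤-trans (ℕ.≤-reflexive (isolated i v v∈i)) z≤n
    where

    ∈-tabulate : ∀ {P : Fin n → Set} (P? : ∀ u → Dec (P u)) {u} →
                 u ∈ Vec.tabulate (does ∘ P?) → P u
    ∈-tabulate P? {u} u∈
      with P? u | trans (sym (Vec.lookup∘tabulate (does ∘ P?) u)) (Vec.[]=⇒lookup u∈)
    ... | yes p | _ = p

    isolated : ∀ i v → v ∈ colourClass G id i → degreeIn G (colourClass G id i) v ≡ 0
    isolated i v v∈i = trans (cong ∣_∣ (Empty-unique λ (u , u∈) →
      let u∈N , u∈i = x∈p∩q⁻ (neighbours G v) (colourClass G id i) u∈
          v≡u = trans (∈-tabulate (Fin._≟ i) v∈i) (sym (∈-tabulate (Fin._≟ i) u∈i))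
      in ~-irrefl G v≡u (∈-tabulate (_~?_ G v) u∈N))) (∣⊥∣≡0 n)

  χ-attained : ∀ k → Colourable G k (χ G k)
  χ-attained k = argmin-all id {P = Colourable G k} (n-colourable k)
    (all-filter (colourable? G k) (upTo n))

  χ-least : ∀ k c → Colourable G k c → χ G k ℕ.≤ c
  χ-least k c col with c ℕ.<? n
  ... | yes c<n = All.lookup (min≤xs n _)
                    (∈-filter⁺ (colourable? G k) (∈-upTo⁺ c<n) col)
  ... | no  c≮n = ℕ.≤-trans (min≤⊤ n (filter (colourable? G k) (upTo n))) (ℕ.≮⇒≥ c≮n)

  minDegree-least : ∀ v → minDegree G ℕ.≤ degree G v
  minDegree-least v = All.lookup (min≤xs n _) (∈-tabulate⁺ {f = degree G} v)

minDegree-attained : ∀ {n} .{{_ : ℕ.NonZero n}} (G : Graph n) →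
                     ∃[ v ] degree G v ≡ minDegree G
minDegree-attained {suc n} G with argmin-sel id (suc n) (degrees G)
... | inj₁ δ≡n = zero , ℕ.≤-antisym
        (ℕ.≤-trans (∣p∣≤n (neighbours G zero)) (ℕ.≤-reflexive (sym δ≡n)))
        (minDegree-least G zero)
... | inj₂ δ∈ = let v , δ≡ = ∈-tabulate⁻ {f = degree G} δ∈ in v , sym δ≡

toℚ : ℕ → ℚ
toℚ m = ℤ.+ m ℚ./ 1

χ≢0 : ∀ {n} .{{_ : ℕ.NonZero n}} (G : Graph n) k → ℕ.NonZero (χ G k)
χ≢0 {suc n} G k with χ G k | χ-attained G k
... | zero  | f , _ with () ← f zero
... | suc _ | _ = _

sum-tabulate-≥ : ∀ {m n} (f : Fin n → ℕ) → (∀ i → m ℕ.≤ f i) →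
                 m ℕ.* n ℕ.≤ sum (List.tabulate f)
sum-tabulate-≥ {m} {zero}  f m≤f = ℕ.≤-reflexive (ℕ.*-zeroʳ m)
sum-tabulate-≥ {m} {suc n} f m≤f = ℕ.≤-trans (ℕ.≤-reflexive (ℕ.*-suc m n))
  (ℕ.+-mono-≤ (m≤f zero) (sum-tabulate-≥ (f ∘ suc) (m≤f ∘ suc)))

minDegree≤averageDegree : ∀ {n} .{{_ : ℕ.NonZero n}} (G : Graph n) →
                          toℚ (minDegree G) ℚ.≤ averageDegree G
minDegree≤averageDegree {suc n} G = ℚ.toℚᵘ-cancel-≤ (begin
  ℚ.toℚᵘ (toℚ δ)              ≃⟨ ℚ.toℚᵘ-fromℚᵘ (ℚᵘ.mkℚᵘ (ℤ.+ δ) 0) ⟩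
  ℚᵘ.mkℚᵘ (ℤ.+ δ) 0           ≤⟨ ℚᵘ.*≤* δn≤s ⟩
  ℚᵘ.mkℚᵘ (ℤ.+ s) n           ≃⟨ ℚ.toℚᵘ-fromℚᵘ (ℚᵘ.mkℚᵘ (ℤ.+ s) n) ⟨
  ℚ.toℚᵘ (averageDegree G)    ∎)
  where
  open ℚᵘ.≤-Reasoning
  δ = minDegree G
  s = sum (degrees G)
  δn≤s : ℤ.+ δ ℤ.* ℤ.+ suc n ℤ.≤ ℤ.+ s ℤ.* ℤ.+ 1
  δn≤s rewrite sym (ℤ.pos-* δ (suc n)) | sym (ℤ.pos-* s 1) | ℕ.*-identityʳ s =
    ℤ.+≤+ (sum-tabulate-≥ (degree G) (minDegree-least G))

p≤q⇒0≤q-p : ∀ {p q} → p ℚ.≤ q → ℚ.0ℚ ℚ.≤ q ℚ.- p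
p≤q⇒0≤q-p {p} {q} p≤q =
  subst (ℚ._≤ q ℚ.- p) (ℚ.+-inverseʳ p) (ℚ.+-monoˡ-≤ (ℚ.- p) p≤q)

bound-denominator≢0 : ∀ {n} .{{_ : ℕ.NonZero n}} (G : Graph n) k →
  let d = averageDegree G
      δ = toℚ (minDegree G)
  in ℚ.NonZero ((toℚ 2 ℚ.* d ℚ.- toℚ 2 ℚ.* δ ℚ.+ 1ℚ) ℚ.* toℚ (χ G k))
bound-denominator≢0 G k = ℚ.pos⇒nonZero ((y ℚ.+ 1ℚ) ℚ.* toℚ (χ G k)) {{denominator>0}}
  where
  d = averageDegree G
  δ = toℚ (minDegree G)
  y = toℚ 2 ℚ.* d ℚ.- toℚ 2 ℚ.* δ

  y≥0 : ℚ.NonNegative y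
  y≥0 = ℚ.nonNegative (p≤q⇒0≤q-p (ℚ.*-monoˡ-≤-nonNeg (toℚ 2) (minDegree≤averageDegree G)))

  χ>0 : ℚ.Positive (toℚ (χ G k))
  χ>0 = ℚ.normalize-pos (χ G k) 1 {{_}} {{χ≢0 G k}}

  denominator>0 : ℚ.Positive ((y ℚ.+ 1ℚ) ℚ.* toℚ (χ G k))
  denominator>0 = ℚ.pos*pos⇒pos (y ℚ.+ 1ℚ) {{ℚ.nonNeg+pos⇒pos y {{y≥0}} 1ℚ}} (toℚ (χ G k)) {{χ>0}}

{-# OPTIONS --safe #-}

-- Colour the vertices with χ_k(G) colours. A set of vertices of equal degree and equal colour
-- is k-independent and regular, so at most M = α_{k-reg}(G) χ_k(G) vertices share a degree.
-- Put x(v) = deg(v) − δ. Every pair (u , v) has x(u) < x(v) or x(v) ≤ x(u); for a fixed v the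
-- first holds for at most x(v) M vertices u, and for a fixed u the second holds for at most
-- (x(u) + 1) M vertices v. Hence n² ≤ Σ_v (2 x(v) + 1) M = n (2d − 2δ + 1) M.

module Submission where

open import Defs
open import Data.Nat.Base using (ℕ; NonZero)
open import Data.Rational.Base using (1ℚ; _+_; _-_; _*_; _÷_; _≤_)

import Algebra.Properties.Semiring.Sum as Sum
open import Data.Bool.Base using (Bool; true; false)
open import Data.Fin.Base using (Fin; zero; suc; toℕ)
import Data.Fin.Properties as Fin
open import Data.Fin.Subset using (Subset; inside; outside; _∈_; _⊆_; _∩_; ∁; ∣_∣)
open import Data.Fin.Subset.Properties
  using (_∈?_; Empty-unique; ∣⊥∣≡0; ∣p∣≤n; ∣∁p∣≡n∸∣p∣; p⊆q⇒∣p∣≤∣q∣; p∩q⊆p;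
         x∈p∩q⁺; x∈p∩q⁻; x∈∁p⇒x∉p)
import Data.Integer.Base as ℤ
import Data.Integer.Properties as ℤ
import Data.List.Base as List using (tabulate)
open import Data.Nat.Base as ℕ using (zero; suc; s≤s; z≤n)
import Data.Nat.ListAction as List using (sum)
import Data.Nat.Properties as ℕ
import Data.Nat.Tactic.RingSolver as ℕ-Solver
open import Data.Product.Base using (_,_; proj₁; proj₂)
open import Data.Rational.Base as ℚ using (ℚ; 0ℚ)
import Data.Rational.Properties as ℚ
open import Data.Rational.Solver using (module +-*-Solver)
import Data.Rational.Unnormalised.Base as ℚᵘ
import Data.Rational.Unnormalised.Properties as ℚᵘ
open import Data.Vec.Base as Vec using ([]; _∷_)
import Data.Vec.Properties as Vec
open import Function.Base using (_∘_)
open import Relation.Binary.PropositionalEquality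
open import Relation.Nullary.Decidable using (Dec; does; dec-true; yes; no)

open Sum ℕ.+-*-semiring
  using (sum; sum-cong-≗; ∑-distrib-+; ∑-comm; *-distribʳ-sum)

private
  variable
    n : ℕ

-- Subsets and sums

IsConstantOn : {A : Set} → (Fin n → A) → Subset n → Set
IsConstantOn f S = ∀ u → u ∈ S → ∀ v → v ∈ S → f u ≡ f v

module _ {P : Fin n → Set} (P? : ∀ u → Dec (P u)) where

  ∈-tabulate⁺ : ∀ {u} → P u → u ∈ Vec.tabulate (does ∘ P?)
  ∈-tabulate⁺ {u} p = Vec.lookup⇒[]= u _
    (trans (Vec.lookup∘tabulate (does ∘ P?) u) (dec-true (P? u) p))

  ∈-tabulate⁻ : ∀ {u} → u ∈ Vec.tabulate (does ∘ P?) → P u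
  ∈-tabulate⁻ {u} u∈
    with P? u | trans (sym (Vec.lookup∘tabulate (does ∘ P?) u)) (Vec.[]=⇒lookup u∈)
  ... | yes p | _ = p

∣p∣≡∣p∩q∣+∣p∩∁q∣ : (p q : Subset n) → ∣ p ∣ ≡ ∣ p ∩ q ∣ ℕ.+ ∣ p ∩ ∁ q ∣
∣p∣≡∣p∩q∣+∣p∩∁q∣ []            []            = refl
∣p∣≡∣p∩q∣+∣p∩∁q∣ (outside ∷ p) (y       ∷ q) = ∣p∣≡∣p∩q∣+∣p∩∁q∣ p q
∣p∣≡∣p∩q∣+∣p∩∁q∣ (inside  ∷ p) (inside  ∷ q) = cong suc (∣p∣≡∣p∩q∣+∣p∩∁q∣ p q)
∣p∣≡∣p∩q∣+∣p∩∁q∣ (inside  ∷ p) (outside ∷ q) =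
  trans (cong suc (∣p∣≡∣p∩q∣+∣p∩∁q∣ p q)) (sym (ℕ.+-suc _ _))

-- On `S` the function `x` takes at most the `m` values `0, …, m - 1`, so `S` splits into at most
-- `m` level sets of size at most `M`; the induction on `m` peels off the top level. It is applied
-- both to degree excess and to colour. Only subsets of `S` need the bound `M`, so that in the
-- second use they inherit the regularity of `S`.
∣S∣≤m*M : ∀ (x : Fin n → ℕ) {M} m S → (∀ u → u ∈ S → x u ℕ.< m) →
          (∀ T → T ⊆ S → IsConstantOn x T → ∣ T ∣ ℕ.≤ M) → ∣ S ∣ ℕ.≤ m ℕ.* M
∣S∣≤m*M {n} x zero S x<0 _ with Fin.any? (λ u → u ∈? S)
... | yes (u , u∈S) with () ← x<0 u u∈S
... | no  empty = ℕ.≤-reflexive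
  (trans (cong ∣_∣ (Empty-unique empty)) (∣⊥∣≡0 n))
∣S∣≤m*M x {M} (suc m) S x<1+m bound = begin
  ∣ S ∣                          ≡⟨ ∣p∣≡∣p∩q∣+∣p∩∁q∣ S Q ⟩
  ∣ S ∩ Q ∣ ℕ.+ ∣ S ∩ ∁ Q ∣      ≤⟨ ℕ.+-mono-≤ ∣S∩Q∣≤M ∣S∩∁Q∣≤m*M ⟩
  M ℕ.+ m ℕ.* M                  ∎
  where
  open ℕ.≤-Reasoning
  x≟m = λ u → x u ℕ.≟ m
  Q = Vec.tabulate (does ∘ x≟m)

  x≡m : ∀ {u} → u ∈ S ∩ Q → x u ≡ m
  x≡m u∈ = ∈-tabulate⁻ x≟m (proj₂ (x∈p∩q⁻ S Q u∈))

  ∣S∩Q∣≤M = bound (S ∩ Q) (p∩q⊆p S Q) λ u u∈ v v∈ → trans (x≡m u∈) (sym (x≡m v∈))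

  -- Outside `Q` the value `m` is missed, so `x u < suc m` sharpens to `x u < m`.
  ∣S∩∁Q∣≤m*M = ∣S∣≤m*M x m (S ∩ ∁ Q)
    (λ u u∈ → let u∈S , u∈∁Q = x∈p∩q⁻ S (∁ Q) u∈ in
      ℕ.≤∧≢⇒< (ℕ.s≤s⁻¹ (x<1+m u u∈S)) (x∈∁p⇒x∉p u∈∁Q ∘ ∈-tabulate⁺ x≟m))
    (λ T T⊆ → bound T (p∩q⊆p S (∁ Q) ∘ T⊆))

sum-mono-≤ : {f g : Fin n → ℕ} → (∀ i → f i ℕ.≤ g i) → sum f ℕ.≤ sum g
sum-mono-≤ {zero}  f≤g = z≤n
sum-mono-≤ {suc n} f≤g = ℕ.+-mono-≤ (f≤g zero) (sum-mono-≤ (f≤g ∘ suc))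

sum-const : ∀ n c → sum {n} (λ _ → c) ≡ n ℕ.* c
sum-const zero    c = refl
sum-const (suc n) c = cong (c ℕ.+_) (sum-const n c)

sum-tabulate : (f : Fin n → ℕ) → List.sum (List.tabulate f) ≡ sum f
sum-tabulate {zero}  f = refl
sum-tabulate {suc n} f = cong (f zero ℕ.+_) (sum-tabulate (f ∘ suc))

-- Counting ordered pairs of vertices

indicator : Bool → ℕ
indicator true  = 1
indicator false = 0

∣tabulate∣ : (b : Fin n → Bool) → ∣ Vec.tabulate b ∣ ≡ sum (indicator ∘ b)
∣tabulate∣ {zero}  b = refl
∣tabulate∣ {suc n} b with b zero
... | true  = cong suc (∣tabulate∣ (b ∘ suc))
... | false = ∣tabulate∣ (b ∘ suc)

-- Both sides count the pairs `(u , v)` with `b u v` true, once by rows and once by columns.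
double-counting : (b : Fin n → Fin n → Bool) →
  sum (λ u → ∣ Vec.tabulate (b u) ∣) ≡ sum (λ v → ∣ Vec.tabulate (λ u → b u v) ∣)
double-counting b = begin
  sum (λ u → ∣ Vec.tabulate (b u) ∣)            ≡⟨ sum-cong-≗ (∣tabulate∣ ∘ b) ⟩
  sum (λ u → sum (λ v → indicator (b u v)))     ≡⟨ ∑-comm (λ u v → indicator (b u v)) ⟩
  sum (λ v → sum (λ u → indicator (b u v)))     ≡⟨ sum-cong-≗ (λ v → ∣tabulate∣ (λ u → b u v)) ⟨
  sum (λ v → ∣ Vec.tabulate (λ u → b u v) ∣)    ∎
  where open ≡-Reasoning

n²≤[2∑x+n]*M : ∀ (x : Fin n → ℕ) {M} → (∀ T → IsConstantOn x T → ∣ T ∣ ℕ.≤ M) →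
               n ℕ.* n ℕ.≤ (2 ℕ.* sum x ℕ.+ n) ℕ.* M
n²≤[2∑x+n]*M {n} x {M} bound = begin
  n ℕ.* n
    ≡⟨ sum-const n n ⟨
  sum {n} (λ _ → n)
    ≡⟨ sum-cong-≗ ∣above∣+∣∁above∣≡n ⟨
  sum (λ u → ∣ above u ∣ ℕ.+ ∣ ∁ (above u) ∣)
    ≡⟨ ∑-distrib-+ (∣_∣ ∘ above) (λ u → ∣ ∁ (above u) ∣) ⟩
  sum (∣_∣ ∘ above) ℕ.+ sum (λ u → ∣ ∁ (above u) ∣)
    -- The value `x u` does not limit how many levels lie above it, but only `x v` levels lie below
    -- `x v`. Hence the strict pairs are regrouped by their larger member.
    ≡⟨ cong (ℕ._+ sum (λ u → ∣ ∁ (above u) ∣)) (double-counting (λ u v → does (x u ℕ.<? x v))) ⟩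
  sum (∣_∣ ∘ below) ℕ.+ sum (λ u → ∣ ∁ (above u) ∣)
    ≤⟨ ℕ.+-mono-≤ (sum-mono-≤ ∣below∣≤) (sum-mono-≤ ∣∁above∣≤) ⟩
  sum (λ v → x v ℕ.* M) ℕ.+ sum (λ u → M ℕ.+ x u ℕ.* M)
    ≡⟨ cong (sum (λ v → x v ℕ.* M) ℕ.+_) (∑-distrib-+ (λ _ → M) (λ u → x u ℕ.* M)) ⟩
  sum (λ v → x v ℕ.* M) ℕ.+ (sum {n} (λ _ → M) ℕ.+ sum (λ u → x u ℕ.* M))
    ≡⟨ cong₂ (λ a b → a ℕ.+ (b ℕ.+ a)) (sym (*-distribʳ-sum M x)) (sum-const n M) ⟩
  sum x ℕ.* M ℕ.+ (n ℕ.* M ℕ.+ sum x ℕ.* M)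
    ≡⟨ rearrange (sum x) n M ⟩
  (2 ℕ.* sum x ℕ.+ n) ℕ.* M
    ∎
  where
  open ℕ.≤-Reasoning

  above below : Fin n → Subset n
  above u = Vec.tabulate (λ v → does (x u ℕ.<? x v))
  below v = Vec.tabulate (λ u → does (x u ℕ.<? x v))

  ∣above∣+∣∁above∣≡n : ∀ u → ∣ above u ∣ ℕ.+ ∣ ∁ (above u) ∣ ≡ n
  ∣above∣+∣∁above∣≡n u = trans (cong (∣ above u ∣ ℕ.+_) (∣∁p∣≡n∸∣p∣ (above u)))
                               (ℕ.m+[n∸m]≡n (∣p∣≤n (above u)))

  ∣below∣≤ : ∀ v → ∣ below v ∣ ℕ.≤ x v ℕ.* M
  ∣below∣≤ v = ∣S∣≤m*M x (x v) (below v)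
    (λ u u∈ → ∈-tabulate⁻ (λ u → x u ℕ.<? x v) u∈) (λ T _ → bound T)

  -- The complement consists of the `v` with `x v ≤ x u`, so the level of `u` itself counts too.
  -- This extra level, summed over all `u`, gives the term `n`, and in the end the `1` in
  -- `2d - 2δ + 1`.
  ∣∁above∣≤ : ∀ u → ∣ ∁ (above u) ∣ ℕ.≤ suc (x u) ℕ.* M
  ∣∁above∣≤ u = ∣S∣≤m*M x (suc (x u)) (∁ (above u))
    (λ v v∈ → s≤s (ℕ.≮⇒≥ (x∈∁p⇒x∉p v∈ ∘ ∈-tabulate⁺ (λ v → x u ℕ.<? x v))))
    (λ T _ → bound T)

  rearrange : ∀ s n M → s ℕ.* M ℕ.+ (n ℕ.* M ℕ.+ s ℕ.* M) ≡ (2 ℕ.* s ℕ.+ n) ℕ.* M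
  rearrange = ℕ-Solver.solve-∀

-- Graphs

module _ (G : Graph n) where

  degreeIn-mono-⊆ : ∀ {S T} v → S ⊆ T → degreeIn G S v ℕ.≤ degreeIn G T v
  degreeIn-mono-⊆ {S} v S⊆T = p⊆q⇒∣p∣≤∣q∣ λ u∈ →
    let u∈N , u∈S = x∈p∩q⁻ (neighbours G v) S u∈ in x∈p∩q⁺ (u∈N , S⊆T u∈S)

  -- Levels are counted from the minimum degree upwards, which is how `δ` enters the bound. The
  -- truncated subtraction is exact by `minDegree-least`.
  excess : Fin n → ℕ
  excess v = degree G v ℕ.∸ minDegree G

  excess+minDegree≡degree : ∀ v → excess v ℕ.+ minDegree G ≡ degree G v
  excess+minDegree≡degree v = ℕ.m∸n+n≡m (minDegree-least G v)

  -- This is `n d = t + δ n` for the total excess `t`, before division by `n`; it turns `2 t + n`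
  -- into `n (2d - 2δ + 1)`.
  sum-degrees : List.sum (degrees G) ≡ sum excess ℕ.+ minDegree G ℕ.* n
  sum-degrees = begin
    List.sum (degrees G)                        ≡⟨ sum-tabulate (degree G) ⟩
    sum (degree G)                              ≡⟨ sum-cong-≗ excess+minDegree≡degree ⟨
    sum (λ v → excess v ℕ.+ minDegree G)        ≡⟨ ∑-distrib-+ excess (λ _ → minDegree G) ⟩
    sum excess ℕ.+ sum {n} (λ _ → minDegree G)  ≡⟨ cong (sum excess ℕ.+_) (sum-const n _) ⟩
    sum excess ℕ.+ n ℕ.* minDegree G            ≡⟨ cong (sum excess ℕ.+_) (ℕ.*-comm n _) ⟩
    sum excess ℕ.+ minDegree G ℕ.* n            ∎
    where open ≡-Reasoning

module _ (G : Graph n) (k : ℕ) where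

  -- For each `v` in `S`, the set `S` lies inside the colour class of `f v`, and passing to a subset
  -- cannot raise the induced degree of `v`.
  monochromatic⇒independent : ∀ {c} {f : Fin n → Fin c} {S} → IsColouring G k f →
                              IsConstantOn f S → IsIndependent G k S
  monochromatic⇒independent {f = f} f-col f-const v v∈S = ℕ.≤-trans
    (degreeIn-mono-⊆ G v λ u∈S → ∈-tabulate⁺ (λ u → f u Fin.≟ f v) (f-const _ u∈S v v∈S))
    (f-col (f v) v (∈-tabulate⁺ (λ u → f u Fin.≟ f v) refl))

  -- An optimal colouring cuts `S` into at most `χ G k` monochromatic pieces. Each is
  -- `k`-independent and still regular, so `α-reg G k` bounds its size.
  regular⇒∣S∣≤χ*α : ∀ S → IsDegreeRegular G S → ∣ S ∣ ℕ.≤ χ G k ℕ.* α-reg G k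
  regular⇒∣S∣≤χ*α S reg = let f , f-col = χ-attained G k in
    ∣S∣≤m*M (toℕ ∘ f) (χ G k) S (λ u _ → Fin.toℕ<n (f u)) λ T T⊆S f-const →
      α-reg-greatest G k T
        (monochromatic⇒independent f-col λ u u∈ v v∈ → Fin.toℕ-injective (f-const u u∈ v v∈))
        (λ u u∈ v v∈ → reg u (T⊆S u∈) v (T⊆S v∈))

  n²≤[2∑excess+n]*χ*α :
    n ℕ.* n ℕ.≤ (2 ℕ.* sum (excess G) ℕ.+ n) ℕ.* (χ G k ℕ.* α-reg G k)
  -- Adding `minDegree G` back shows that equal excess means equal degree, so `M` can be
  -- `χ G k * α-reg G k`.
  n²≤[2∑excess+n]*χ*α = n²≤[2∑x+n]*M (excess G) λ T const → regular⇒∣S∣≤χ*α T λ u u∈ v v∈ →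
    trans (sym (excess+minDegree≡degree G u))
          (trans (cong (ℕ._+ minDegree G) (const u u∈ v v∈))
                 (excess+minDegree≡degree G v))

-- Rational arithmetic

toℚᵘ-toℚ : ∀ m → ℚ.toℚᵘ (toℚ m) ℚᵘ.≃ ℚᵘ.mkℚᵘ (ℤ.+ m) 0
toℚᵘ-toℚ m = ℚ.toℚᵘ-fromℚᵘ (ℚᵘ.mkℚᵘ (ℤ.+ m) 0)

toℚ-homo-+ : ∀ a b → toℚ (a ℕ.+ b) ≡ toℚ a + toℚ b
toℚ-homo-+ a b = ℚ.toℚᵘ-injective (begin
  ℚ.toℚᵘ (toℚ (a ℕ.+ b))                    ≈⟨ toℚᵘ-toℚ (a ℕ.+ b) ⟩
  ℚᵘ.mkℚᵘ (ℤ.+ (a ℕ.+ b)) 0                 ≈⟨ ℚᵘ.*≡* (cong (ℤ._* ℤ.1ℤ) (sym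
    (cong₂ ℤ._+_ (ℤ.*-identityʳ (ℤ.+ a)) (ℤ.*-identityʳ (ℤ.+ b))))) ⟩
  ℚᵘ.mkℚᵘ (ℤ.+ a) 0 ℚᵘ.+ ℚᵘ.mkℚᵘ (ℤ.+ b) 0  ≈⟨ ℚᵘ.+-cong (toℚᵘ-toℚ a) (toℚᵘ-toℚ b) ⟨
  ℚ.toℚᵘ (toℚ a) ℚᵘ.+ ℚ.toℚᵘ (toℚ b)        ≈⟨ ℚ.toℚᵘ-homo-+ (toℚ a) (toℚ b) ⟨
  ℚ.toℚᵘ (toℚ a + toℚ b)                    ∎)
  where open ℚᵘ.≃-Reasoning

toℚ-homo-* : ∀ a b → toℚ (a ℕ.* b) ≡ toℚ a * toℚ b
toℚ-homo-* a b = ℚ.toℚᵘ-injective (begin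
  ℚ.toℚᵘ (toℚ (a ℕ.* b))                    ≈⟨ toℚᵘ-toℚ (a ℕ.* b) ⟩
  ℚᵘ.mkℚᵘ (ℤ.+ (a ℕ.* b)) 0                 ≈⟨ ℚᵘ.*≡* (cong (ℤ._* ℤ.1ℤ) (ℤ.pos-* a b)) ⟩
  ℚᵘ.mkℚᵘ (ℤ.+ a) 0 ℚᵘ.* ℚᵘ.mkℚᵘ (ℤ.+ b) 0  ≈⟨ ℚᵘ.*-cong (toℚᵘ-toℚ a) (toℚᵘ-toℚ b) ⟨
  ℚ.toℚᵘ (toℚ a) ℚᵘ.* ℚ.toℚᵘ (toℚ b)        ≈⟨ ℚ.toℚᵘ-homo-* (toℚ a) (toℚ b) ⟨
  ℚ.toℚᵘ (toℚ a * toℚ b)                    ∎)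
  where open ℚᵘ.≃-Reasoning

toℚ-mono-≤ : ∀ {a b} → a ℕ.≤ b → toℚ a ≤ toℚ b
toℚ-mono-≤ {a} {b} a≤b = ℚ.toℚᵘ-cancel-≤ (begin
  ℚ.toℚᵘ (toℚ a)     ≃⟨ toℚᵘ-toℚ a ⟩
  ℚᵘ.mkℚᵘ (ℤ.+ a) 0  ≤⟨ ℚᵘ.*≤* (ℤ.*-monoʳ-≤-nonNeg ℤ.1ℤ (ℤ.+≤+ a≤b)) ⟩
  ℚᵘ.mkℚᵘ (ℤ.+ b) 0  ≃⟨ toℚᵘ-toℚ b ⟨
  ℚ.toℚᵘ (toℚ b)     ∎)
  where open ℚᵘ.≤-Reasoning

m/n*n≡m : ∀ m n .{{_ : NonZero n}} → (ℤ.+ m ℚ./ n) * toℚ n ≡ toℚ m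
m/n*n≡m m (suc n) = ℚ.toℚᵘ-injective (begin
  ℚ.toℚᵘ ((ℤ.+ m ℚ./ suc n) * toℚ (suc n))
    ≈⟨ ℚ.toℚᵘ-homo-* (ℤ.+ m ℚ./ suc n) (toℚ (suc n)) ⟩
  ℚ.toℚᵘ (ℤ.+ m ℚ./ suc n) ℚᵘ.* ℚ.toℚᵘ (toℚ (suc n))
    ≈⟨ ℚᵘ.*-cong (ℚ.toℚᵘ-fromℚᵘ (ℚᵘ.mkℚᵘ (ℤ.+ m) n)) (toℚᵘ-toℚ (suc n)) ⟩
  ℚᵘ.mkℚᵘ (ℤ.+ m) n ℚᵘ.* ℚᵘ.mkℚᵘ (ℤ.+ suc n) 0
    ≈⟨ ℚᵘ.*≡* (trans (ℤ.*-identityʳ _)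
         (cong (λ d → ℤ.+ m ℤ.* ℤ.+ d) (sym (ℕ.*-identityʳ (suc n))))) ⟩
  ℚᵘ.mkℚᵘ (ℤ.+ m) 0
    ≈⟨ toℚᵘ-toℚ m ⟨
  ℚ.toℚᵘ (toℚ m)
    ∎)
  where open ℚᵘ.≃-Reasoning

p≤r*q⇒p÷q≤r : ∀ p q r .{{_ : ℚ.NonZero q}} .{{_ : ℚ.Positive q}} → p ≤ r * q → p ÷ q ≤ r
p≤r*q⇒p÷q≤r p q r p≤r*q = ℚ.*-cancelʳ-≤-pos q (begin
  p * ℚ.1/ q * q    ≡⟨ ℚ.*-assoc p (ℚ.1/ q) q ⟩
  p * (ℚ.1/ q * q)  ≡⟨ cong (p *_) (ℚ.*-inverseˡ q) ⟩
  p * 1ℚ            ≡⟨ ℚ.*-identityʳ p ⟩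
  p                 ≤⟨ p≤r*q ⟩
  r * q             ∎)
  where open ℚ.≤-Reasoning

-- The bound over the rationals

module _ .{{_ : NonZero n}} (G : Graph n) (k : ℕ) where
  private
    d = averageDegree G
    δ = toℚ (minDegree G)
    c = toℚ (χ G k)
    α = toℚ (α-reg G k)
    t = sum (excess G)
    w = 2 ℕ.* t ℕ.+ n

  boundDenominator : ℚ
  boundDenominator = (toℚ 2 * d - toℚ 2 * δ + 1ℚ) * c

  -- The factor `n` clears the denominator of the average degree, and the `δ` terms then cancel.
  -- What remains is a natural number, so that the counting inequality applies.
  boundDenominator*n : boundDenominator * toℚ n ≡ toℚ (w ℕ.* χ G k)
  boundDenominator*n = begin
    boundDenominator * toℚ n
      ≡⟨ solve 5 (λ a d δ c n → (a :* d :- a :* δ :+ con 1ℚ) :* c :* n :=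
                   (a :* (d :* n) :- a :* (δ :* n) :+ n) :* c) refl (toℚ 2) d δ c (toℚ n) ⟩
    (toℚ 2 * (d * toℚ n) - toℚ 2 * (δ * toℚ n) + toℚ n) * c
      ≡⟨ cong (λ s → (toℚ 2 * s - toℚ 2 * (δ * toℚ n) + toℚ n) * c) d*n≡t+δ*n ⟩
    (toℚ 2 * (toℚ t + δ * toℚ n) - toℚ 2 * (δ * toℚ n) + toℚ n) * c
      ≡⟨ solve 5 (λ a t e n c → (a :* (t :+ e) :- a :* e :+ n) :* c := (a :* t :+ n) :* c)
               refl (toℚ 2) (toℚ t) (δ * toℚ n) (toℚ n) c ⟩
    (toℚ 2 * toℚ t + toℚ n) * c
      ≡⟨ cong (λ s → (s + toℚ n) * c) (toℚ-homo-* 2 t) ⟨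
    (toℚ (2 ℕ.* t) + toℚ n) * c
      ≡⟨ cong (_* c) (toℚ-homo-+ (2 ℕ.* t) n) ⟨
    toℚ w * c
      ≡⟨ toℚ-homo-* w (χ G k) ⟨
    toℚ (w ℕ.* χ G k)
      ∎
    where
    open ≡-Reasoning
    open +-*-Solver

    d*n≡t+δ*n : d * toℚ n ≡ toℚ t + δ * toℚ n
    d*n≡t+δ*n = begin
      d * toℚ n                              ≡⟨ m/n*n≡m (List.sum (degrees G)) n ⟩
      toℚ (List.sum (degrees G))             ≡⟨ cong toℚ (sum-degrees G) ⟩
      toℚ (t ℕ.+ minDegree G ℕ.* n)          ≡⟨ toℚ-homo-+ t (minDegree G ℕ.* n) ⟩
      toℚ t + toℚ (minDegree G ℕ.* n)        ≡⟨ cong (toℚ t +_) (toℚ-homo-* (minDegree G) n) ⟩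
      toℚ t + δ * toℚ n                      ∎

  toℚn>0 : ℚ.Positive (toℚ n)
  toℚn>0 = ℚ.normalize-pos n 1

  -- Its product with the positive `n` is a natural number, so it is nonnegative;
  -- `bound-denominator≢0` excludes zero.
  boundDenominator>0 : ℚ.Positive boundDenominator
  boundDenominator>0 = ℚ.nonNeg∧nonZero⇒pos boundDenominator
    {{ℚ.nonNegative (ℚ.*-cancelʳ-≤-pos {0ℚ} {boundDenominator} (toℚ n) {{toℚn>0}} (begin
      0ℚ * toℚ n                ≡⟨ ℚ.*-zeroˡ (toℚ n) ⟩
      toℚ 0                     ≤⟨ toℚ-mono-≤ (z≤n {w ℕ.* χ G k}) ⟩
      toℚ (w ℕ.* χ G k)         ≡⟨ boundDenominator*n ⟨
      boundDenominator * toℚ n  ∎))}}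
    {{bound-denominator≢0 G k}}
    where open ℚ.≤-Reasoning

  -- This is the counting inequality `n² ≤ w χ α` with `w χ` rewritten as `boundDenominator * n` and
  -- one factor `n` cancelled.
  n≤α*boundDenominator : toℚ n ≤ α * boundDenominator
  n≤α*boundDenominator = ℚ.*-cancelʳ-≤-pos (toℚ n) {{toℚn>0}} (begin
    toℚ n * toℚ n                      ≡⟨ toℚ-homo-* n n ⟨
    toℚ (n ℕ.* n)                      ≤⟨ toℚ-mono-≤ (n²≤[2∑excess+n]*χ*α G k) ⟩
    toℚ (w ℕ.* (χ G k ℕ.* α-reg G k))  ≡⟨ cong toℚ (ℕ.*-assoc w _ _) ⟨
    toℚ (w ℕ.* χ G k ℕ.* α-reg G k)    ≡⟨ cong toℚ (ℕ.*-comm (w ℕ.* χ G k) _) ⟩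
    toℚ (α-reg G k ℕ.* (w ℕ.* χ G k))  ≡⟨ toℚ-homo-* (α-reg G k) (w ℕ.* χ G k) ⟩
    α * toℚ (w ℕ.* χ G k)              ≡⟨ cong (α *_) boundDenominator*n ⟨
    α * (boundDenominator * toℚ n)     ≡⟨ ℚ.*-assoc α boundDenominator (toℚ n) ⟨
    α * boundDenominator * toℚ n       ∎)
    where open ℚ.≤-Reasoning

proposition1p1 :
  ∀ {n : ℕ} .{{_ : NonZero n}} (k : ℕ) (G : Graph n) →
  let d = averageDegree G
      δ = toℚ (minDegree G)
  in (toℚ n ÷ ((toℚ 2 * d - toℚ 2 * δ + 1ℚ) * toℚ (χ G k))) {{bound-denominator≢0 G k}}
       ≤ toℚ (α-reg G k)
proposition1p1 k G = p≤r*q⇒p÷q≤r _ (boundDenominator G k) (toℚ (α-reg G k))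
  {{bound-denominator≢0 G k}} {{boundDenominator>0 G k}} (n≤α*boundDenominator G k)
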